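{- The axiomatic system $\mathbf{K}^\circ$ is sound and strongly complete with respect to the class of all frames. That is, with $F$ the class of all frames: every theorem of $\mathbf{K}^\circ$ is valid on $F$ (soundness), and for every set $\Gamma\cup\{\phi\}$ of $\mathcal{L}(\circ)$-formulas, if $\Gamma\vDash_F\phi$ then $\Gamma\vdash_{\mathbf{K}^\circ}\phi$ (strong completeness).
   Context: Let $\mathbf{P}$ be a set of propositional variables, with $p,q\in\mathbf{P}$ distinct. The language $\mathcal{L}(\circ)$ is given by $\phi::=r\mid\neg\phi\mid(\phi\land\phi)\mid\circ\phi$ with $r\in\mathbf{P}$; other Boolean connectives and $\top$ are the usual abbreviations. A frame is $\langle S,R\rangle$ with $S$ a nonempty set and $R\subseteq S\times S$; a model based on it is $\mathcal{M}=\langle S,R,V\rangle$ with $V:\mathbf{P}\to\mathcal{P}(S)$. Satisfaction: $\mathcal{M},s\vDash r$ iff $s\in V(r)$; Booleans as usual; $\mathcal{M},s\vDash\circ\phi$ iff ($\mathcal{M},s\vDash\phi$ implies that $\mathcal{M},t\vDash\phi$ for all $t$ with $sRt$). For a class $F$ of frames, $\phi$ is valid on $F$ if $\mathcal{M},s\vDash\phi$ for every model $\mathcal{M}$ based on a frame in $F$ and every $s$ in $\mathcal{M}$; $\Gamma\vDash_F\phi$ means: for every model $\mathcal{M}$ based on a frame in $F$ and every $s$ in $\mathcal{M}$, if $\mathcal{M},s\vDash\gamma$ for all $\gamma\in\Gamma$ then $\mathcal{M},s\vDash\phi$. The system $\mathbf{K}^\circ$ has as axioms all propositional tautologies, $\circ\top$,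 $\neg p\to\circ p$, and $\circ p\land\circ q\to\circ(p\land q)$, and as inference rules uniform substitution, modus ponens, and the rule: from $\phi\to\psi$ infer $\circ\phi\land\phi\to\circ\psi$. A derivation from $\Gamma$ to $\phi$ in the system, written $\Gamma\vdash\phi$ (with the system as subscript), is a finite sequence of $\mathcal{L}(\circ)$-formulas (ending in $\phi$) in which each formula is either an instantiation of an axiom, or an element of $\Gamma$, or the result of applying an inference rule to prior formulas in the sequence. A theorem is a formula $\phi$ for which there is a derivation from $\emptyset$ to $\phi$. -}

module Defs where

open import Data.Bool.Base using (Bool; true; not) renaming (_∧_ to _and_)
open import Data.List.Base using (List; []; _∷_)
open import Data.List.Membership.Propositional renaming (_∈_ to _∈ˡ_)
open import Data.Product.Base using (_×_; ∃-syntax)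
open import Level using (0ℓ)
open import Relation.Binary.Core using (Rel)
open import Relation.Binary.PropositionalEquality.Core using (_≡_)
open import Relation.Nullary.Negation.Core using (¬_)
open import Relation.Unary using (Pred; _∈_; ∅; U)

infix  9 ~_
infix  9 ∘_
infixr 7 _∧_
infixr 5 _⇒_

data Form (P : Set) : Set where
  var : P → Form P
  ~_  : Form P → Form P
  _∧_ : Form P → Form P → Form P
  ∘_  : Form P → Form P

_⇒_ : ∀ {P} → Form P → Form P → Form P
φ ⇒ ψ = ~ (φ ∧ ~ ψ)

-- The language has no constants, so ⊤ abbreviates a tautology in a chosen
-- variable.
verum : ∀ {P} → P → Form P
verum p = ~ (var p ∧ ~ var p)

_[_] : ∀ {P} → Form P → (P → Form P) → Form P
var r   [ σ ] = σ r
(~ φ)   [ σ ] = ~ (φ [ σ ])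
(φ ∧ ψ) [ σ ] = (φ [ σ ]) ∧ (ψ [ σ ])
(∘ φ)   [ σ ] = ∘ (φ [ σ ])

record Frame : Set₁ where
  field
    S         : Set
    inhabited : S
    R         : Rel S 0ℓ

Valuation : Set → Frame → Set₁
Valuation P 𝓕 = P → Pred (Frame.S 𝓕) 0ℓ

record Model (P : Set) : Set₁ where
  field
    frame : Frame
    V     : Valuation P frame
  open Frame frame public

infix 4 _,_⊨_
_,_⊨_ : ∀ {P} (𝓜 : Model P) → Model.S 𝓜 → Form P → Set
𝓜 , s ⊨ var r = s ∈ Model.V 𝓜 r
𝓜 , s ⊨ ~ φ   = ¬ (𝓜 , s ⊨ φ)
𝓜 , s ⊨ φ ∧ ψ = (𝓜 , s ⊨ φ) × (𝓜 , s ⊨ ψ)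
𝓜 , s ⊨ ∘ φ   = 𝓜 , s ⊨ φ → ∀ t → Model.R 𝓜 s t → 𝓜 , t ⊨ φ

FrameClass : Set₁
FrameClass = Pred Frame 0ℓ

allFrames : FrameClass
allFrames = U

ValidOn : ∀ {P} → FrameClass → Form P → Set₁
ValidOn {P} F φ =
  (𝓜 : Model P) → Model.frame 𝓜 ∈ F → (s : Model.S 𝓜) → 𝓜 , s ⊨ φ

infix 4 _⊨[_]_
_⊨[_]_ : ∀ {P} → Pred (Form P) 0ℓ → FrameClass → Form P → Set₁
_⊨[_]_ {P} Γ F φ =
  (𝓜 : Model P) → Model.frame 𝓜 ∈ F → (s : Model.S 𝓜) →
  (∀ γ → γ ∈ Γ → 𝓜 , s ⊨ γ) → 𝓜 , s ⊨ φ

-- Truth-table evaluation. Variables and formulas ∘ φ are the propositional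
-- atoms; only the values of v at such formulas are used.
eval : ∀ {P} → (Form P → Bool) → Form P → Bool
eval v (var r) = v (var r)
eval v (~ φ)   = not (eval v φ)
eval v (φ ∧ ψ) = eval v φ and eval v ψ
eval v (∘ φ)   = v (∘ φ)

Tautology : ∀ {P} → Form P → Set
Tautology φ = ∀ v → eval v φ ≡ true

module K∘ {P : Set} (p q : P) where

  -- Apart from the tautologies these are single formulas in the fixed
  -- variables p and q, not schemes.
  data Axiom : Form P → Set where
    taut : ∀ {φ} → Tautology φ → Axiom φ
    ∘⊤   : Axiom (∘ verum p)
    ¬∘   : Axiom (~ var p ⇒ ∘ var p)
    ∘∧   : Axiom (∘ var p ∧ ∘ var q ⇒ ∘ (var p ∧ var q))

  -- Every rule, uniform substitution included, may be applied to any prior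
  -- formula, also to one that depends on elements of Γ.
  data Justified (Γ : Pred (Form P) 0ℓ) (prior : List (Form P)) :
                 Form P → Set where
    axiom   : ∀ {α} → Axiom α → ∀ σ → Justified Γ prior (α [ σ ])
    premise : ∀ {φ} → φ ∈ Γ → Justified Γ prior φ
    subst   : ∀ {φ} → φ ∈ˡ prior → ∀ σ → Justified Γ prior (φ [ σ ])
    mp      : ∀ {φ ψ} → φ ∈ˡ prior → (φ ⇒ ψ) ∈ˡ prior → Justified Γ prior ψ
    mono    : ∀ {φ ψ} → (φ ⇒ ψ) ∈ˡ prior →
              Justified Γ prior (∘ φ ∧ φ ⇒ ∘ ψ)

  -- Sequences are listed in reverse: the head is the last formula.
  data Derivation (Γ : Pred (Form P) 0ℓ) : List (Form P) → Set where
    []  : Derivation Γ []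
    _∷_ : ∀ {φ prior} → Justified Γ prior φ → Derivation Γ prior →
          Derivation Γ (φ ∷ prior)

  infix 4 _⊢_
  _⊢_ : Pred (Form P) 0ℓ → Form P → Set
  Γ ⊢ φ = ∃[ prior ] Derivation Γ (φ ∷ prior)

  Theorem : Form P → Set
  Theorem φ = ∅ ⊢ φ

  Sound : FrameClass → Set₁
  Sound F = ∀ φ → Theorem φ → ValidOn F φ

  StronglyComplete : FrameClass → Set₁
  StronglyComplete F = ∀ Γ φ → Γ ⊨[ F ] φ → Γ ⊢ φ

{-# OPTIONS --safe #-}

-- Soundness reads a satisfaction relation as a truth-table valuation, using
-- excluded middle.  For completeness the worlds of the canonical model are the
-- truth-table valuations that verify a given logic T, and u is accessible from
-- w when ψ is true at u for all ψ such that ψ and ∘ ψ are true at w.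
-- These ψ form a theory, because of ∘⊤, ∘∧ and the monotonicity rule, so that
-- Lindenbaum's lemma yields the successors required by the truth lemma.
--
-- Lindenbaum's lemma for an arbitrary set P of variables would need a choice
-- principle.  It is avoided because substitution may be applied to premises:
-- if σ sends the variables not in φ to p, then T = { ψ ∣ Γ ⊢ ψ [ σ ] }
-- contains Γ, and modulo T there are only countably many formulas.

module Submission where

open import Defs
open import Axiom.ExcludedMiddle using (ExcludedMiddle)
open import Data.Bool.Base using (Bool; true; false; not; if_then_else_)
  renaming (_∧_ to _and_)
open import Data.Bool.Properties using (∧-conicalˡ; ∧-conicalʳ)
open import Data.List.Base
  using (List; []; _∷_; _++_; map; foldl; cartesianProductWith)
open import Data.List.Membership.Propositional using () renaming (_∈_ to _∈ˡ_)
open import Data.List.Membership.Propositional.Properties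
  using (∈-++⁺ˡ; ∈-++⁺ʳ; ∈-map⁺; ∈-cartesianProductWith⁺)
open import Data.List.Relation.Binary.Subset.Propositional using (_⊆_)
open import Data.List.Relation.Binary.Subset.Propositional.Properties
  using (xs⊆xs++ys)
open import Data.List.Relation.Unary.All as All using (All; []; _∷_)
open import Data.List.Relation.Unary.Any using (here; there)
open import Data.Nat.Base using (ℕ; zero; suc; _⊔_; _≤_; _≤′_; ≤′-refl; ≤′-step)
open import Data.Nat.Properties using (m≤m⊔n; m≤n⊔m; ≤⇒≤′)
open import Data.Product.Base using (_×_; _,_; proj₁; ∃-syntax; map₂)
open import Data.Sum.Base as Sum using (_⊎_; inj₁; inj₂; [_,_]′)
open import Data.Unit.Base using (tt)
open import Function.Base using (id)
open import Function.Bundles using (_⇔_; mk⇔; module Equivalence)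
open import Level using (0ℓ)
open import Relation.Binary.PropositionalEquality.Core
  using (_≡_; _≢_; refl; sym; cong; cong₂) renaming (subst to transport)
open import Relation.Nullary.Decidable.Core
  using (yes; no; does; proof; decidable-stable)
open import Relation.Nullary.Negation.Core using (¬_; contradiction)
open import Relation.Nullary.Reflects
  using (Reflects; ofʸ; ofⁿ; ¬-reflects; _×-reflects_)
open import Relation.Unary using (Pred; _∈_; _∉_) renaming (_⊆_ to _⊆ᵖ_)

open Equivalence using (to; from)

private variable
  P : Set

-- Truth-table computations

≡true-reflects : ∀ b → Reflects (b ≡ true) b
≡true-reflects true  = ofʸ refl
≡true-reflects false = ofⁿ λ ()

Reflects-true : ∀ {A : Set} {b} → Reflects A b → A ⇔ (b ≡ true)
Reflects-true (ofʸ a)  = mk⇔ (λ _ → refl) (λ _ → a)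
Reflects-true (ofⁿ ¬a) = mk⇔ (λ a → contradiction a ¬a) (λ ())

Reflects-⇔ : ∀ {A B : Set} {b} → A ⇔ B → Reflects A b → Reflects B b
Reflects-⇔ e (ofʸ a)  = ofʸ (to e a)
Reflects-⇔ e (ofⁿ ¬a) = ofⁿ λ b → ¬a (from e b)

implies-elim : ∀ a b → not (a and not b) ≡ true → a ≡ true → b ≡ true
implies-elim true true _ _ = refl

implies-intro : ∀ a b → (a ≡ true → b ≡ true) → not (a and not b) ≡ true
implies-intro false b     f = refl
implies-intro true  true  f = refl
implies-intro true  false f = f refl

and-intro : ∀ {a b} → a ≡ true → b ≡ true → a and b ≡ true
and-intro refl refl = refl

Tautology-⇒ : ∀ (ψ χ : Form P) →
  (∀ v → eval v ψ ≡ true → eval v χ ≡ true) → Tautology (ψ ⇒ χ)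
Tautology-⇒ ψ χ f v = implies-intro (eval v ψ) (eval v χ) (f v)

-- Theories and their extension by one formula

record Theory (X : Pred (Form P) 0ℓ) : Set where
  field
    tautology : ∀ {ψ} → Tautology ψ → X ψ
    detach    : ∀ {ψ χ} → X (ψ ⇒ χ) → X ψ → X χ

  consequence : ∀ {ψ χ} →
    (∀ v → eval v ψ ≡ true → eval v χ ≡ true) → X ψ → X χ
  consequence {ψ} {χ} f = detach (tautology (Tautology-⇒ ψ χ f))

  consequence₂ : ∀ {α β χ} →
    (∀ v → eval v α ≡ true → eval v β ≡ true → eval v χ ≡ true) →
    X α → X β → X χ
  consequence₂ {α} {β} {χ} f x y = detach (consequence
    (λ v a → implies-intro (eval v β) (eval v χ) (f v a)) x) y

open Theory

-- By the deduction theorem this is the least theory containing `ψ` and a given theory `X`, as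
-- detachment is the only rule.
extend : Pred (Form P) 0ℓ → Form P → Pred (Form P) 0ℓ
extend X ψ χ = X (ψ ⇒ χ)

extend-⊆ : ∀ {X : Pred (Form P) 0ℓ} → Theory X → ∀ ψ → X ⊆ᵖ extend X ψ
extend-⊆ th ψ {χ} = consequence th
  λ v c → implies-intro (eval v ψ) (eval v χ) λ _ → c

extend-∈ : ∀ {X : Pred (Form P) 0ℓ} → Theory X → ∀ ψ → ψ ∈ extend X ψ
extend-∈ th ψ = tautology th (Tautology-⇒ ψ ψ λ _ → id)

extend-theory : ∀ {X : Pred (Form P) 0ℓ} → Theory X → ∀ ψ → Theory (extend X ψ)
extend-theory th ψ = record
  { tautology = λ t → extend-⊆ th ψ (tautology th t)
  ; detach    = λ {α} {β} → consequence₂ th λ v x y →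
      implies-intro (eval v ψ) (eval v β) λ a →
        implies-elim (eval v α) (eval v β)
          (implies-elim (eval v ψ) (eval v (α ⇒ β)) x a)
          (implies-elim (eval v ψ) (eval v α) y a)
  }

-- Formulas generated by depth from a finite base

formulas : List (Form P) → ℕ → List (Form P)
formulas base zero    = base
formulas base (suc n) =
  fs ++ map ~_ fs ++ map ∘_ fs ++ cartesianProductWith _∧_ fs fs
  where fs = formulas base n

formulas-mono : ∀ (base : List (Form P)) {m n} → m ≤ n →
  formulas base m ⊆ formulas base n
formulas-mono base m≤n = go (≤⇒≤′ m≤n)
  where
  go : ∀ {m n} → m ≤′ n → formulas base m ⊆ formulas base n
  go ≤′-refl       = id
  go (≤′-step m≤n) i = ∈-++⁺ˡ (go m≤n i)

formulas-cover : ∀ {base} {σ : P → Form P} → (∀ r → σ r ∈ˡ base) →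
  ∀ ψ → ∃[ n ] ψ [ σ ] ∈ˡ formulas base n
formulas-cover σ∈ (var r) = 0 , σ∈ r
formulas-cover {base = base} σ∈ (~ ψ) with formulas-cover σ∈ ψ
... | n , i = suc n , ∈-++⁺ʳ fs (∈-++⁺ˡ (∈-map⁺ ~_ i))
  where fs = formulas base n
formulas-cover {base = base} σ∈ (∘ ψ) with formulas-cover σ∈ ψ
... | n , i = suc n , ∈-++⁺ʳ fs (∈-++⁺ʳ (map ~_ fs) (∈-++⁺ˡ (∈-map⁺ ∘_ i)))
  where fs = formulas base n
formulas-cover {base = base} σ∈ (ψ ∧ χ)
  with m , i ← formulas-cover σ∈ ψ | n , j ← formulas-cover σ∈ χ =
  suc k , ∈-++⁺ʳ fs (∈-++⁺ʳ (map ~_ fs) (∈-++⁺ʳ (map ∘_ fs)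
    (∈-cartesianProductWith⁺ _∧_
      (formulas-mono base (m≤m⊔n m n) i)
      (formulas-mono base (m≤n⊔m m n) j))))
  where
  k  = m ⊔ n
  fs = formulas base k

-- Substitution in formulas and in models

variables : Form P → List P
variables (var r) = r ∷ []
variables (~ ψ)   = variables ψ
variables (ψ ∧ χ) = variables ψ ++ variables χ
variables (∘ ψ)   = variables ψ

[]-identity : ∀ {σ : P → Form P} ψ →
  (∀ {r} → r ∈ˡ variables ψ → σ r ≡ var r) → ψ [ σ ] ≡ ψ
[]-identity (var r) h = h (here refl)
[]-identity (~ ψ)   h = cong ~_ ([]-identity ψ h)
[]-identity (ψ ∧ χ) h = cong₂ _∧_
  ([]-identity ψ λ i → h (∈-++⁺ˡ i))
  ([]-identity χ λ i → h (∈-++⁺ʳ (variables ψ) i))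
[]-identity (∘ ψ)   h = cong ∘_ ([]-identity ψ h)

[]-idempotent : ∀ {σ : P → Form P} → (∀ r → σ r [ σ ] ≡ σ r) →
  ∀ ψ → ψ [ σ ] [ σ ] ≡ ψ [ σ ]
[]-idempotent h (var r) = h r
[]-idempotent h (~ ψ)   = cong ~_ ([]-idempotent h ψ)
[]-idempotent h (ψ ∧ χ) = cong₂ _∧_ ([]-idempotent h ψ) ([]-idempotent h χ)
[]-idempotent h (∘ ψ)   = cong ∘_ ([]-idempotent h ψ)

_⟨_⟩ : Model P → (P → Form P) → Model P
𝓜 ⟨ σ ⟩ = record { frame = Model.frame 𝓜 ; V = λ r s → 𝓜 , s ⊨ σ r }

-- Substitution amounts to a change of valuation on the same frame; hence uniform substitution
-- preserves validity.
⊨-[] : ∀ (𝓜 : Model P) σ ψ {s} → (𝓜 , s ⊨ ψ [ σ ]) ⇔ (𝓜 ⟨ σ ⟩ , s ⊨ ψ)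
⊨-[] 𝓜 σ (var r) = mk⇔ id id
⊨-[] 𝓜 σ (~ ψ)   = mk⇔
  (λ n x → n (from (⊨-[] 𝓜 σ ψ) x)) (λ n x → n (to (⊨-[] 𝓜 σ ψ) x))
⊨-[] 𝓜 σ (ψ ∧ χ) = mk⇔
  (λ (x , y) → to (⊨-[] 𝓜 σ ψ) x , to (⊨-[] 𝓜 σ χ) y)
  (λ (x , y) → from (⊨-[] 𝓜 σ ψ) x , from (⊨-[] 𝓜 σ χ) y)
⊨-[] 𝓜 σ (∘ ψ)   = mk⇔
  (λ f x t r → to (⊨-[] 𝓜 σ ψ) (f (from (⊨-[] 𝓜 σ ψ) x) t r))
  (λ f x t r → from (⊨-[] 𝓜 σ ψ) (f (to (⊨-[] 𝓜 σ ψ) x) t r))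

-- Boolean predicates as truth-table valuations

record IsBoolean (X : Pred (Form P) 0ℓ) : Set where
  field
    X-~ : ∀ ψ → (¬ X ψ) ⇔ X (~ ψ)
    X-∧ : ∀ ψ χ → (X ψ × X χ) ⇔ X (ψ ∧ χ)

open IsBoolean

module Classical (em : ExcludedMiddle 0ℓ) where

  by-contradiction : ∀ {A : Set} → ¬ ¬ A → A
  by-contradiction = decidable-stable em

  characteristic : Pred (Form P) 0ℓ → Form P → Bool
  characteristic X ψ = does (em {X ψ})

  -- At the atoms of `eval`, variables and formulas `∘ ψ`, the characteristic function is right by
  -- definition; the Boolean laws of `X` do the rest. This serves both satisfaction at a world and
  -- complete theories.
  eval-reflects : ∀ {X : Pred (Form P) 0ℓ} → IsBoolean X →
    ∀ ψ → Reflects (X ψ) (eval (characteristic X) ψ)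
  eval-reflects b (var r) = proof em
  eval-reflects b (~ ψ)   = Reflects-⇔ (X-~ b ψ) (¬-reflects (eval-reflects b ψ))
  eval-reflects b (ψ ∧ χ) =
    Reflects-⇔ (X-∧ b ψ χ) (eval-reflects b ψ ×-reflects eval-reflects b χ)
  eval-reflects b (∘ ψ)   = proof em

  -- Lindenbaum's lemma

  module _ (φ : Form P) where

    -- Consistency relative to `φ`: the formula kept out is the one to be refuted.
    record Avoiding (X : Pred (Form P) 0ℓ) : Set where
      field
        theory : Theory X
        avoids : φ ∉ X

    open Avoiding

    -- Explosion turns avoidance into consistency: a theory with both `ψ` and `~ ψ` would contain
    -- `φ`.
    complete⇒Boolean : ∀ {X} → Avoiding X → (∀ ψ → X ψ ⊎ X (~ ψ)) → IsBoolean X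
    complete⇒Boolean {X} av complete = record
      { X-~ = λ ψ → mk⇔
          (λ n → [ (λ x → contradiction x n) , id ]′ (complete ψ))
          (λ n x → avoids av (consequence₂ (theory av)
            (λ v → explosion (eval v ψ)) n x))
      ; X-∧ = λ ψ χ → mk⇔
          (λ (x , y) → consequence₂ (theory av) (λ _ → and-intro) x y)
          (λ z → consequence (theory av)
                   (λ v → ∧-conicalˡ (eval v ψ) (eval v χ)) z
               , consequence (theory av)
                   (λ v → ∧-conicalʳ (eval v ψ) (eval v χ)) z)
      }
      where
      explosion : ∀ a {b} → not a ≡ true → a ≡ true → b ≡ true
      explosion true () _

    decide : Pred (Form P) 0ℓ → Form P → Pred (Form P) 0ℓ
    decide X ψ = extend X (if does (em {X (ψ ⇒ φ)}) then ~ ψ else ψ)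

    decide-⊆ : ∀ {X} → Avoiding X → ∀ ψ → X ⊆ᵖ decide X ψ
    decide-⊆ av ψ = extend-⊆ (theory av) _

    decide-∈ : ∀ {X} → Avoiding X → ∀ ψ → decide X ψ ψ ⊎ decide X ψ (~ ψ)
    decide-∈ {X} av ψ with em {X (ψ ⇒ φ)}
    ... | yes _ = inj₂ (extend-∈ (theory av) (~ ψ))
    ... | no  _ = inj₁ (extend-∈ (theory av) ψ)

    -- `X (ψ ⇒ φ)` says that adding `ψ` brings in `φ`. If so, adding `~ ψ` cannot do the same, since
    -- a case distinction on `ψ` would already put `φ` into `X`.
    decide-avoiding : ∀ {X} → Avoiding X → ∀ ψ → Avoiding (decide X ψ)
    decide-avoiding {X} av ψ =
      record { theory = extend-theory (theory av) _ ; avoids = avoids′ }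
      where
      cases : ∀ a {b} → not (a and not b) ≡ true →
        not (not a and not b) ≡ true → b ≡ true
      cases true  {true} _ _ = refl
      cases false {true} _ _ = refl

      avoids′ : φ ∉ decide X ψ
      avoids′ with em {X (ψ ⇒ φ)}
      ... | yes x = λ y →
        avoids av (consequence₂ (theory av) (λ v → cases (eval v ψ)) x y)
      ... | no ¬x = ¬x

    decideAll-avoiding : ∀ {X} → Avoiding X → ∀ ψs → Avoiding (foldl decide X ψs)
    decideAll-avoiding av []       = av
    decideAll-avoiding av (ψ ∷ ψs) = decideAll-avoiding (decide-avoiding av ψ) ψs

    decideAll-⊆ : ∀ {X} → Avoiding X → ∀ ψs → X ⊆ᵖ foldl decide X ψs
    decideAll-⊆ av []       x = x
    decideAll-⊆ av (ψ ∷ ψs) x =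
      decideAll-⊆ (decide-avoiding av ψ) ψs (decide-⊆ av ψ x)

    decideAll-∈ : ∀ {X} → Avoiding X → ∀ {ψ ψs} → ψ ∈ˡ ψs →
      foldl decide X ψs ψ ⊎ foldl decide X ψs (~ ψ)
    decideAll-∈ av {ψ} {_ ∷ ψs} (here refl) =
      Sum.map (decideAll-⊆ av′ ψs) (decideAll-⊆ av′ ψs) (decide-∈ av ψ)
      where av′ = decide-avoiding av ψ
    decideAll-∈ av {ψs = χ ∷ _} (there i) = decideAll-∈ (decide-avoiding av χ) i

    module Stages (L : ℕ → List (Form P)) {X} (av : Avoiding X) where

      stage : ℕ → Pred (Form P) 0ℓ
      stage zero    = X
      stage (suc n) = foldl decide (stage n) (L n)

      stage-avoiding : ∀ n → Avoiding (stage n)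
      stage-avoiding zero    = av
      stage-avoiding (suc n) = decideAll-avoiding (stage-avoiding n) (L n)

      stage-mono : ∀ {m n} → m ≤ n → stage m ⊆ᵖ stage n
      stage-mono m≤n = go (≤⇒≤′ m≤n)
        where
        go : ∀ {m n} → m ≤′ n → stage m ⊆ᵖ stage n
        go ≤′-refl         x = x
        go (≤′-step {n} m≤n) x = decideAll-⊆ (stage-avoiding n) (L n) (go m≤n x)

      limit : Pred (Form P) 0ℓ
      limit ψ = ∃[ n ] stage n ψ

      limit-avoiding : Avoiding limit
      limit-avoiding = record
        { theory = record
          { tautology = λ t → 0 , tautology (theory av) t
          ; detach    = λ (m , x) (n , y) → m ⊔ n ,
              detach (theory (stage-avoiding (m ⊔ n)))
                (stage-mono (m≤m⊔n m n) x) (stage-mono (m≤n⊔m m n) y)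
          }
        ; avoids = λ (n , x) → avoids (stage-avoiding n) x
        }

      limit-∈ : ∀ {n ψ} → ψ ∈ˡ L n → limit ψ ⊎ limit (~ ψ)
      limit-∈ {n} i =
        -- The list `L n` is worked through between stage `n` and stage `suc n`.
        Sum.map (suc n ,_) (suc n ,_) (decideAll-∈ (stage-avoiding n) i)

  -- Countability of the language modulo `X`: each formula is equivalent to a listed one. The second
  -- implication is contraposed so that a decision for `~ χ` passes to `~ ψ` by detachment.
  Exhausts : (ℕ → List (Form P)) → Pred (Form P) 0ℓ → Set
  Exhausts L X = ∀ ψ → ∃[ n ] ∃[ χ ] χ ∈ˡ L n × X (χ ⇒ ψ) × X (~ χ ⇒ ~ ψ)

  -- The limit of the stages decides every listed formula, and through the equivalences already in
  -- `X` every formula. Its characteristic function is the valuation sought.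
  lindenbaum : ∀ {L} {X : Pred (Form P) 0ℓ} → Exhausts L X → Theory X →
    ∀ {φ} → φ ∉ X →
    ∃[ v ] (∀ {ψ} → X ψ → eval v ψ ≡ true) × eval v φ ≢ true
  lindenbaum {L = L} {X} exhausts th {φ} φ∉X =
      characteristic limit
    , (λ {ψ} x → to (true⇔ ψ) (0 , x))
    , λ e → Avoiding.avoids limit-avoiding (from (true⇔ φ) e)
    where
    X-avoiding : Avoiding φ X
    X-avoiding = record { theory = th ; avoids = φ∉X }

    open Stages φ L X-avoiding

    complete : ∀ ψ → limit ψ ⊎ limit (~ ψ)
    complete ψ with n , χ , i , χ⇒ψ , ~χ⇒~ψ ← exhausts ψ =
      Sum.map (detach (Avoiding.theory limit-avoiding) (0 , χ⇒ψ))
              (detach (Avoiding.theory limit-avoiding) (0 , ~χ⇒~ψ))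
              (limit-∈ i)

    true⇔ : ∀ ψ → limit ψ ⇔ (eval (characteristic limit) ψ ≡ true)
    true⇔ ψ = Reflects-true
      (eval-reflects (complete⇒Boolean φ limit-avoiding complete) ψ)

  -- The canonical model and the truth lemma

  record Logic (p : P) (T : Pred (Form P) 0ℓ) : Set where
    field
      theory   : Theory T
      ∘-verum  : T (∘ verum p)
      ~⇒∘      : ∀ ψ → T (~ ψ ⇒ ∘ ψ)
      ∘-∧      : ∀ ψ χ → T (∘ ψ ∧ ∘ χ ⇒ ∘ (ψ ∧ χ))
      ∘-mono   : ∀ {ψ χ} → T (ψ ⇒ χ) → T (∘ ψ ∧ ψ ⇒ ∘ χ)

  module Canonical {p : P} {T} (logic : Logic p T)
                   {L} (exhausts : Exhausts L T) where
    open Logic logic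

    -- Boolean-valued functions in place of maximal theories keep the worlds in `Set`, as a `Frame`
    -- demands; predicates on formulas would land in `Set₁`.
    World : Set
    World = ∃[ v ] (∀ {ψ} → T ψ → eval v ψ ≡ true)

    infix 4 _⊩_
    _⊩_ : World → Form P → Set
    (v , _) ⊩ ψ = eval v ψ ≡ true

    ⊩-⇒ : ∀ w {ψ χ} → T (ψ ⇒ χ) → w ⊩ ψ → w ⊩ χ
    ⊩-⇒ (v , h) {ψ} {χ} t = implies-elim (eval v ψ) (eval v χ) (h t)

    Persistent : World → Pred (Form P) 0ℓ
    Persistent w ψ = w ⊩ ψ × w ⊩ ∘ ψ

    -- Derived necessitation: `verum p ⇒ ψ` is in `T`, so monotonicity gives
    -- `∘ verum p ∧ verum p ⇒ ∘ ψ`, whose antecedent is true at `w`.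
    persistent-T : ∀ w → T ⊆ᵖ Persistent w
    persistent-T w@(v , h) {ψ} t =
        h t
      , ⊩-⇒ w {∘ verum p ∧ verum p} {∘ ψ}
          (∘-mono (extend-⊆ theory (verum p) t))
          (and-intro (h ∘-verum)
            -- `verum p` is by definition `var p ⇒ var p`.
            (implies-intro (v (var p)) (v (var p)) id))

    -- For detachment, `∘-∧` merges `∘ (ψ ⇒ χ)` and `∘ ψ` into `∘` of a conjunction that
    -- tautologically implies `χ`. Monotonicity then yields `∘ χ`, because the conjunction itself is
    -- true at `w`.
    persistent-theory : ∀ w → Theory (Persistent w)
    persistent-theory w@(v , _) = record
      { tautology = λ t → persistent-T w (tautology theory t)
      ; detach    = λ {ψ} {χ} (x , ∘x) (y , ∘y) →
          let z = implies-elim (eval v ψ) (eval v χ) x y in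
          z , ⊩-⇒ w {∘ ((ψ ⇒ χ) ∧ ψ) ∧ ((ψ ⇒ χ) ∧ ψ)} {∘ χ}
                (∘-mono (tautology theory
                  (Tautology-⇒ ((ψ ⇒ χ) ∧ ψ) χ λ u e →
                    implies-elim (eval u ψ) (eval u χ)
                      (∧-conicalˡ _ _ e) (∧-conicalʳ _ _ e))))
                (and-intro
                  (⊩-⇒ w {∘ (ψ ⇒ χ) ∧ ∘ ψ} {∘ ((ψ ⇒ χ) ∧ ψ)}
                    (∘-∧ (ψ ⇒ χ) ψ) (and-intro ∘x ∘y))
                  (and-intro x y))
      }

    Acc : World → World → Set
    Acc w u = ∀ {ψ} → Persistent w ψ → u ⊩ ψ

    -- As `∘ ψ` fails at `w`, `ψ` lies outside the theory `Persistent w`. That theory includes `T`,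
    -- so the same lists exhaust the language modulo it, and the valuation obtained verifies `T`.
    successor : ∀ w ψ → ¬ w ⊩ ∘ ψ → ∃[ u ] Acc w u × ¬ u ⊩ ψ
    successor w ψ n
      with v , h , f ← lindenbaum
             (λ χ → map₂ (map₂ (map₂ λ (a , b) →
               persistent-T w a , persistent-T w b)) (exhausts χ))
             (persistent-theory w) {ψ} (λ (_ , x) → n x) =
      (v , λ t → h (persistent-T w t)) , h , f

    -- The parameter witnesses nonemptiness: if `T` contained every formula, there would be no
    -- worlds.
    model : World → Model P
    model w = record
      { frame = record { S = World ; inhabited = w ; R = Acc }
      ; V     = λ r w → w ⊩ var r
      }

    truth : ∀ w₀ ψ w → Reflects (model w₀ , w ⊨ ψ) (eval (proj₁ w) ψ)
    truth w₀ (var r) w = ≡true-reflects _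
    truth w₀ (~ ψ)   w = ¬-reflects (truth w₀ ψ w)
    truth w₀ (ψ ∧ χ) w = truth w₀ ψ w ×-reflects truth w₀ χ w
    truth w₀ (∘ ψ)   w = Reflects-⇔ (mk⇔ ⊩⇒⊨ ⊨⇒⊩) (≡true-reflects _)
      where
      ψ⇔ : ∀ u → (model w₀ , u ⊨ ψ) ⇔ (u ⊩ ψ)
      ψ⇔ u = Reflects-true (truth w₀ ψ u)

      ⊩⇒⊨ : w ⊩ ∘ ψ → model w₀ , w ⊨ ∘ ψ
      ⊩⇒⊨ x y u wu = from (ψ⇔ u) (wu (to (ψ⇔ w) y , x))

      ⊨⇒⊩ : model w₀ , w ⊨ ∘ ψ → w ⊩ ∘ ψ
      ⊨⇒⊩ f = by-contradiction λ n →
        let u , wu , ¬u = successor w ψ n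
            -- Were `ψ` false at `w`, the axiom `~ ψ ⇒ ∘ ψ` would make `∘ ψ` true there.
            w⊩ψ = by-contradiction λ m →
              n (⊩-⇒ w {~ ψ} {∘ ψ} (~⇒∘ ψ)
                   (to (Reflects-true (¬-reflects (≡true-reflects _))) m))
        in ¬u (to (ψ⇔ u) (f (from (ψ⇔ w) w⊩ψ) u wu))

    countermodel : ∀ {φ} → φ ∉ T →
      ∃[ w ] (∀ {ψ} → T ψ → model w , w ⊨ ψ) × ¬ (model w , w ⊨ φ)
    countermodel {φ} φ∉T with v , h , f ← lindenbaum exhausts theory φ∉T =
        w
      , (λ {ψ} t → from (Reflects-true (truth w ψ w)) (h t))
      , λ x → f (to (Reflects-true (truth w φ w)) x)
      where
      w : World
      w = v , h

  -- Soundness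

  module _ {p q : P} where
    open K∘ p q

    ⊨-Boolean : ∀ (𝓜 : Model P) s → IsBoolean (𝓜 , s ⊨_)
    ⊨-Boolean 𝓜 s = record
      { X-~ = λ _ → mk⇔ id id ; X-∧ = λ _ _ → mk⇔ id id }

    ⊨-detach : ∀ (𝓜 : Model P) {s} ψ χ →
      𝓜 , s ⊨ ψ ⇒ χ → 𝓜 , s ⊨ ψ → 𝓜 , s ⊨ χ
    ⊨-detach 𝓜 ψ χ f x = by-contradiction λ n → f (x , n)

    valid-[] : ∀ (ψ : Form P) → ValidOn allFrames ψ →
      ∀ σ → ValidOn allFrames (ψ [ σ ])
    valid-[] ψ h σ 𝓜 _ s = from (⊨-[] 𝓜 σ ψ) (h (𝓜 ⟨ σ ⟩) tt s)

    axiom-valid : ∀ {α} → Axiom α → ValidOn allFrames α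
    axiom-valid (taut {α} t) 𝓜 _ s =
      from (Reflects-true (eval-reflects (⊨-Boolean 𝓜 s) α)) (t _)
    axiom-valid ∘⊤ 𝓜 _ s _ t _ (x , n) = n x
    axiom-valid ¬∘ 𝓜 _ s (n , f) = f λ x → contradiction x n
    axiom-valid ∘∧ 𝓜 _ s ((f , g) , n) =
      n λ (x , y) t r → f x t r , g y t r

    -- The invariant is validity rather than truth at `s`, because substitution changes the
    -- valuation and the monotonicity rule looks at successors.
    justified-valid : ∀ {Γ prior ψ} → (∀ {γ} → Γ γ → ValidOn allFrames γ) →
      All (ValidOn allFrames) prior → Justified Γ prior ψ → ValidOn allFrames ψ
    justified-valid Γ-valid vs (axiom {α} a σ) = valid-[] α (axiom-valid a) σ
    justified-valid Γ-valid vs (premise i) = Γ-valid i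
    justified-valid Γ-valid vs (subst {ψ} i σ) = valid-[] ψ (All.lookup vs i) σ
    justified-valid Γ-valid vs (mp {ψ} {χ} i j) 𝓜 _ s =
      ⊨-detach 𝓜 ψ χ (All.lookup vs j 𝓜 tt s) (All.lookup vs i 𝓜 tt s)
    justified-valid Γ-valid vs (mono {ψ} {χ} i) 𝓜 _ s ((f , x) , n) =
      n λ _ t r → ⊨-detach 𝓜 ψ χ (All.lookup vs i 𝓜 tt t) (f x t r)

    derivation-valid : ∀ {Γ ψs} → (∀ {γ} → Γ γ → ValidOn allFrames γ) →
      Derivation Γ ψs → All (ValidOn allFrames) ψs
    derivation-valid Γ-valid []      = []
    derivation-valid Γ-valid (j ∷ d) =
      justified-valid Γ-valid vs j ∷ vs
      where vs = derivation-valid Γ-valid d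

    sound : Sound allFrames
    sound ψ (_ , d) = All.head (derivation-valid (λ ()) d)

    -- Derivability from premises

    justified-⊆ : ∀ {Γ ψs χs ψ} → ψs ⊆ χs →
      Justified Γ ψs ψ → Justified Γ χs ψ
    justified-⊆ s (axiom a σ) = axiom a σ
    justified-⊆ s (premise i) = premise i
    justified-⊆ s (subst i σ) = subst (s i) σ
    justified-⊆ s (mp i j)    = mp (s i) (s j)
    justified-⊆ s (mono i)    = mono (s i)

    -- Sequences run backwards, so `e` comes first and each step of `d` still finds its prior
    -- formulas in the longer list.
    _++ᵈ_ : ∀ {Γ ψs χs} →
      Derivation Γ ψs → Derivation Γ χs → Derivation Γ (ψs ++ χs)
    []      ++ᵈ e = e
    (j ∷ d) ++ᵈ e = justified-⊆ (xs⊆xs++ys _ _) j ∷ (d ++ᵈ e)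

    ⊢-axiom : ∀ {Γ α} → Axiom α → ∀ σ → Γ ⊢ α [ σ ]
    ⊢-axiom a σ = [] , axiom a σ ∷ []

    ⊢-mp : ∀ {Γ ψ χ} → Γ ⊢ ψ ⇒ χ → Γ ⊢ ψ → Γ ⊢ χ
    ⊢-mp (ψs , d) (χs , e) =
      _ , mp (∈-++⁺ʳ (_ ∷ ψs) (here refl)) (here refl) ∷ (d ++ᵈ e)

    ⊢-mono : ∀ {Γ ψ χ} → Γ ⊢ ψ ⇒ χ → Γ ⊢ ∘ ψ ∧ ψ ⇒ ∘ χ
    ⊢-mono (_ , d) = _ , mono (here refl) ∷ d

    -- Substitution applied to a premise: this is what places `Γ` inside `T`.
    ⊢-premise-[] : ∀ {Γ γ} → Γ γ → ∀ σ → Γ ⊢ γ [ σ ]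
    ⊢-premise-[] i σ = _ , subst (here refl) σ ∷ premise i ∷ []

    -- The axiom is one formula in `p` and `q`. As these differ, a single substitution can send `p`
    -- to `ψ` and `q`, like all other variables, to `χ`.
    ⊢-∘∧ : ∀ {Γ} → p ≢ q → ∀ ψ χ → Γ ⊢ ∘ ψ ∧ ∘ χ ⇒ ∘ (ψ ∧ χ)
    ⊢-∘∧ {Γ} p≢q ψ χ = transport (Γ ⊢_)
      (cong₂ (λ α β → ∘ α ∧ ∘ β ⇒ ∘ (α ∧ β)) at-p at-q) (⊢-axiom ∘∧ τ)
      where
      τ : P → Form P
      τ r = if does (em {r ≡ p}) then ψ else χ

      at-p : τ p ≡ ψ
      at-p with em {p ≡ p}
      ... | yes _  = refl
      ... | no p≢p = contradiction refl p≢p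

      at-q : τ q ≡ χ
      at-q with em {q ≡ p}
      ... | yes q≡p = contradiction (sym q≡p) p≢q
      ... | no _    = refl

    -- Substitution commutes with the connectives by computation, so each condition is an axiom
    -- instance or a rule at substituted formulas.
    substitution-logic : p ≢ q → ∀ Γ σ → Logic p (λ ψ → Γ ⊢ ψ [ σ ])
    substitution-logic p≢q Γ σ = record
      { theory  = record
        { tautology = λ {ψ} t → ⊢-axiom {α = ψ} (taut t) σ
        ; detach    = ⊢-mp
        }
      ; ∘-verum = ⊢-axiom ∘⊤ σ
      ; ~⇒∘     = λ ψ → ⊢-axiom ¬∘ (λ _ → ψ [ σ ])
      ; ∘-∧     = λ ψ χ → ⊢-∘∧ p≢q (ψ [ σ ]) (χ [ σ ])
      ; ∘-mono  = ⊢-mono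
      }

    -- Completeness by collapsing the variables

    module Collapse (vs : List P) where

      -- Putting `p` into the list makes the default value a fixed point, so that the collapse is
      -- idempotent.
      collapse : P → P
      collapse r = if does (em {r ∈ˡ p ∷ vs}) then r else p

      collapse-∈ : ∀ r → collapse r ∈ˡ p ∷ vs
      collapse-∈ r with em {r ∈ˡ p ∷ vs}
      ... | yes i = i
      ... | no _  = here refl

      collapse-fix : ∀ {r} → r ∈ˡ p ∷ vs → collapse r ≡ r
      collapse-fix {r} i with em {r ∈ˡ p ∷ vs}
      ... | yes _ = refl
      ... | no n  = contradiction i n

      σ : P → Form P
      σ r = var (collapse r)

      σ-idempotent : ∀ ψ → ψ [ σ ] [ σ ] ≡ ψ [ σ ]
      σ-idempotent = []-idempotent λ r → cong var (collapse-fix (collapse-∈ r))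

      -- The representative of `ψ` is `ψ [ σ ]`: by idempotence, applying `σ` turns both
      -- implications into the form `α ⇒ α`.
      exhausts : p ≢ q → ∀ Γ →
        Exhausts (formulas (map var (p ∷ vs))) (λ ψ → Γ ⊢ ψ [ σ ])
      exhausts p≢q Γ ψ
        with n , i ← formulas-cover {σ = σ} (λ r → ∈-map⁺ var (collapse-∈ r)) ψ =
          n , ψ [ σ ] , i
        , transport (λ α → Γ ⊢ α ⇒ ψ [ σ ]) (sym (σ-idempotent ψ)) (⊢-refl (ψ [ σ ]))
        , transport (λ α → Γ ⊢ ~ α ⇒ ~ ψ [ σ ]) (sym (σ-idempotent ψ))
            (⊢-refl (~ ψ [ σ ]))
        where
        ⊢-refl : ∀ α → Γ ⊢ α ⇒ α
        ⊢-refl α = ⊢-axiom {α = var p ⇒ var p}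
          (taut (Tautology-⇒ (var p) (var p) λ _ → id)) (λ _ → α)

    -- The collapse fixes the variables of `φ`, so `φ [ σ ]` is `φ` and an underivable `φ` lies
    -- outside `T`. The resulting countermodel verifies `T`, hence `Γ`.
    complete : p ≢ q → StronglyComplete allFrames
    complete p≢q Γ φ Γ⊨φ = by-contradiction λ Γ⊬φ →
      let w , T⊨ , ⊭φ = countermodel {φ} λ Γ⊢φσ → Γ⊬φ
            (transport (Γ ⊢_)
              ([]-identity φ λ i → cong var (collapse-fix (there i))) Γ⊢φσ)
      in ⊭φ (Γ⊨φ (model w) tt w λ γ i → T⊨ {γ} (⊢-premise-[] i σ))
      where
      open Collapse (variables φ)
      open Canonical (substitution-logic p≢q Γ σ) (exhausts p≢q Γ)

theorem34 : ExcludedMiddle 0ℓ →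
    (P : Set) (p q : P) → p ≢ q →
    K∘.Sound p q allFrames × K∘.StronglyComplete p q allFrames
theorem34 em P p q p≢q = sound , complete p≢q
  where open Classical em
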